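{- For every set of operators $\mathcal O \subseteq \{\Box^*, \Box_P, \Box_F\}$, the parameterised problem $\mathrm{Detect}^{\mathcal O}(\mathrm{KROM})$ is fixed-parameter tractable. That is, there are a computable function $f\colon\mathbb N\to\mathbb N$ and a deterministic algorithm that, given an $\mathrm{LTL}^{\mathcal O}_{\mathrm{CNF}}$ formula $\phi$ and an integer $k\in\mathbb N$, finds a strong $\mathrm{KROM}$-backdoor of $\phi$ of size at most $k$ if one exists (and reports that none exists otherwise), in time $f(k)\cdot |x|^{O(1)}$, where $|x|$ is the size of the input.
   Context: **Formulas.** Let $\mathcal O\subseteq\{\Box_F,\Box_P,\Box^*\}$ be a set of temporal operators ("always in the future", "always in the past", "always"). A temporal literal over $\mathcal O$ is $\bot$, a propositional variable $p$, or $Op$ with $O\in\mathcal O$ and $p$ a propositional variable (operators are not nested). A clause is a disjunction $\lnot\lambda_1\lor\dots\lor\lnot\lambda_n\lor\lambda_{n+1}\lor\dots\lor\lambda_{n+m}$ of negated and positive temporal literals. An $\mathrm{LTL}^{\mathcal O}_{\mathrm{CNF}}$ formula is a formula $\phi=\Psi\land\Box^*\Phi$, where $\Phi$ is a conjunction of clauses over $\mathcal O$ and $\Psi$ is a conjunction of propositional variables from $\Phi$ (the outermost $\Box^*$ is always allowed, regardless of $\mathcal O$). It belongs to $\mathrm{KROM}$ if every clause of $\Phi$ has at most two literals ($n+m\le 2$). $\mathrm{Vars}(\phi)$ is the set of propositional variables of $\phi$. **Backdoors.** Let $X\subseteq \mathrm{Vars}(\phi)$. An assignment $\theta\colon X\cup\{Ox\mid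 x\in X, O\in\mathcal O\}\to\{0,1\}$ is consistent if for every $x\in X$: if $\theta(\Box^* x)=1$ then also $\theta(\Box_P x)=1$, $\theta(\Box_F x)=1$ and $\theta(x)=1$ (the condition concerns only those literals lying in the domain of $\theta$). The reduct $\phi[\theta]$ is obtained from $\phi$ by deleting all clauses containing a literal satisfied by $\theta$ and deleting all literals falsified by $\theta$ from the remaining clauses; empty clauses are replaced by false and the empty formula by true. For a class $\mathcal C$ of formulas, $X$ is a strong $\mathcal C$-backdoor of $\phi$ (with respect to $\mathcal O$) if $\phi[\theta]\in\mathcal C$ for every consistent assignment $\theta\colon X\cup\{Ox\mid x\in X,O\in\mathcal O\}\to\{0,1\}$. **Problem $\mathrm{Detect}^{\mathcal O}(\mathcal C)$.** Input: an $\mathrm{LTL}^{\mathcal O}_{\mathrm{CNF}}$ formula $\phi$ and an integer $k\in\mathbb N$. Parameter: $k$. Task: find a strong $\mathcal C$-backdoor of $\phi$ of size $\le k$ if one exists.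
   Formalization: Input formulas may contain no tautological clause (one satisfied by every consistent assignment of its own variables); without this, clauses ⋁_{x∈S}(x∨¬x) make strong KROM-backdoors exactly hitting sets, so the problem is W[2]-hard and the claim fails unless FPT = W[2]. -}

module Defs where

open import Data.Bool using (Bool; true; false; T; not; if_then_else_; _∨_)
open import Data.Empty using (⊥)
open import Data.Fin using (Fin; zero)
open import Data.List using (List; []; _∷_; [_]; _++_; map; foldr; length; any; filterᵇ; concatMap)
open import Data.List.Membership.Propositional using (_∈_)
open import Data.List.Relation.Binary.Subset.Propositional using (_⊆_)
open import Data.List.Relation.Unary.All using (All)
open import Data.List.Relation.Unary.Unique.Propositional using (Unique)
open import Data.Maybe using (Maybe; just; nothing; Is-just; maybe′)
open import Data.Nat using (ℕ; zero; suc; _+_; _*_; _^_; _≤_)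
open import Data.Nat.Binary using (ℕᵇ; zero; 2[1+_]; 1+[2_]; fromℕ)
open import Data.Product using (Σ; _×_; _,_; Σ-syntax; ∃-syntax)
open import Data.Vec using (Vec; []; _∷_; lookup)
open import Function using (_∘_; id; _⇔_)
open import Relation.Binary.PropositionalEquality using (_≡_; refl)
open import Relation.Nullary using (¬_)

------------------------------------------------------------------------
-- Model of computation: a first-order, call-by-value language over binary
-- trees (in the style of N. Jones, "Computability and Complexity").  Every
-- evaluation step costs one unit.  Building, sharing and taking apart a tree
-- are pointer operations and there is no primitive that inspects or compares
-- more than the root of a tree, so costs agree up to a polynomial with
-- running times of random access and Turing machines.

data Tree : Set where
  nil  : Tree
  cons : Tree → Tree → Tree

size : Tree → ℕ
size nil        = 1
size (cons s t) = suc (size s + size t)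

-- Expressions that may call m mutually recursive unary functions and have n
-- variables in scope.  The innermost variable has index zero; in the second
-- branch of `case`, index zero is the left subtree and index one the right.
data Exp (m n : ℕ) : Set where
  ref  : Fin n → Exp m n
  nil  : Exp m n
  cons : Exp m n → Exp m n → Exp m n
  bind : Exp m n → Exp m (suc n) → Exp m n
  case : Exp m n → Exp m n → Exp m (suc (suc n)) → Exp m n
  call : Fin m → Exp m n → Exp m n

record Program : Set where
  field
    {extra} : ℕ
    bodies  : Vec (Exp (suc extra) 1) (suc extra)

-- fs , ρ ⊢ e ⇓ v ⟨ t ⟩: with function bodies fs and variable values ρ, the
-- expression e evaluates to v in t steps.
data _,_⊢_⇓_⟨_⟩ {m : ℕ} (fs : Vec (Exp m 1) m) {n : ℕ} (ρ : Vec Tree n) :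
     Exp m n → Tree → ℕ → Set where
  ref       : ∀ {i} → fs , ρ ⊢ ref i ⇓ lookup ρ i ⟨ 1 ⟩
  nil       : fs , ρ ⊢ nil ⇓ nil ⟨ 1 ⟩
  cons      : ∀ {e₁ e₂ v₁ v₂ t₁ t₂} →
              fs , ρ ⊢ e₁ ⇓ v₁ ⟨ t₁ ⟩ →
              fs , ρ ⊢ e₂ ⇓ v₂ ⟨ t₂ ⟩ →
              fs , ρ ⊢ cons e₁ e₂ ⇓ cons v₁ v₂ ⟨ suc (t₁ + t₂) ⟩
  bind      : ∀ {e₁ e₂ v₁ v₂ t₁ t₂} →
              fs , ρ ⊢ e₁ ⇓ v₁ ⟨ t₁ ⟩ →
              fs , v₁ ∷ ρ ⊢ e₂ ⇓ v₂ ⟨ t₂ ⟩ →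
              fs , ρ ⊢ bind e₁ e₂ ⇓ v₂ ⟨ suc (t₁ + t₂) ⟩
  case-nil  : ∀ {e e₁ e₂ v t t₁} →
              fs , ρ ⊢ e ⇓ nil ⟨ t ⟩ →
              fs , ρ ⊢ e₁ ⇓ v ⟨ t₁ ⟩ →
              fs , ρ ⊢ case e e₁ e₂ ⇓ v ⟨ suc (t + t₁) ⟩
  case-cons : ∀ {e e₁ e₂ l r v t t₂} →
              fs , ρ ⊢ e ⇓ cons l r ⟨ t ⟩ →
              fs , l ∷ r ∷ ρ ⊢ e₂ ⇓ v ⟨ t₂ ⟩ →
              fs , ρ ⊢ case e e₁ e₂ ⇓ v ⟨ suc (t + t₂) ⟩
  call      : ∀ {i e u v t t′} →
              fs , ρ ⊢ e ⇓ u ⟨ t ⟩ →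
              fs , u ∷ [] ⊢ lookup fs i ⇓ v ⟨ t′ ⟩ →
              fs , ρ ⊢ call i e ⇓ v ⟨ suc (t + t′) ⟩

deterministic : ∀ {m} {fs : Vec (Exp m 1) m} {n} {ρ : Vec Tree n} {e v v′ t t′} →
                fs , ρ ⊢ e ⇓ v ⟨ t ⟩ → fs , ρ ⊢ e ⇓ v′ ⟨ t′ ⟩ → v ≡ v′ × t ≡ t′
deterministic ref ref = refl , refl
deterministic nil nil = refl , refl
deterministic (cons p q) (cons p′ q′)
  with refl , refl ← deterministic p p′ | refl , refl ← deterministic q q′ = refl , refl
deterministic (bind p q) (bind p′ q′)
  with refl , refl ← deterministic p p′
  with refl , refl ← deterministic q q′ = refl , refl
deterministic (case-nil p q) (case-nil p′ q′)
  with refl , refl ← deterministic p p′ | refl , refl ← deterministic q q′ = refl , refl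
deterministic (case-nil p q) (case-cons p′ q′) with () , _ ← deterministic p p′
deterministic (case-cons p q) (case-nil p′ q′) with () , _ ← deterministic p p′
deterministic (case-cons p q) (case-cons p′ q′)
  with refl , refl ← deterministic p p′
  with refl , refl ← deterministic q q′ = refl , refl
deterministic (call p q) (call p′ q′)
  with refl , refl ← deterministic p p′
  with refl , refl ← deterministic q q′ = refl , refl

-- The function with index zero is the entry point.
Runs : Program → (input output : Tree) (time : ℕ) → Set
Runs P u v t = bodies , u ∷ [] ⊢ lookup bodies zero ⇓ v ⟨ t ⟩
  where open Program P

------------------------------------------------------------------------
-- Encodings.  Numbers are written in binary.

codeᵇ : ℕᵇ → Tree
codeᵇ zero     = nil
codeᵇ 2[1+ x ] = cons nil (codeᵇ x)
codeᵇ 1+[2 x ] = cons (cons nil nil) (codeᵇ x)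

codeℕ : ℕ → Tree
codeℕ = codeᵇ ∘ fromℕ

codeList : ∀ {A : Set} → (A → Tree) → List A → Tree
codeList code = foldr (cons ∘ code) nil

codeMaybe : ∀ {A : Set} → (A → Tree) → Maybe A → Tree
codeMaybe code = maybe′ (cons nil ∘ code) nil

------------------------------------------------------------------------
-- Parameterised search problems and fixed-parameter tractability

Computable : (ℕ → ℕ) → Set
Computable f = Σ[ P ∈ Program ] ∀ n → ∃[ t ] Runs P (codeℕ n) (codeℕ (f n)) t

record SearchProblem : Set₁ where
  field
    Instance   : Set
    Candidate  : Set
    codeIn     : Instance → Tree
    codeOut    : Candidate → Tree
    parameter  : Instance → ℕ
    IsSolution : Instance → Candidate → Set

  -- The correct answers: a solution, or `nothing` if there is none.
  Answers : Instance → Maybe Candidate → Set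
  Answers x (just y) = IsSolution x y
  Answers x nothing  = ∀ y → ¬ IsSolution x y

FixedParameterTractable : SearchProblem → Set
FixedParameterTractable Q =
  Σ[ f ∈ (ℕ → ℕ) ] Computable f ×
  Σ[ P ∈ Program ] Σ[ c ∈ ℕ ]
    ∀ (x : Instance) → ∃[ y ] ∃[ t ]
      Answers x y ×
      Runs P (codeIn x) (codeMaybe codeOut y) t ×
      t ≤ f (parameter x) * size (codeIn x) ^ c
  where open SearchProblem Q

------------------------------------------------------------------------
-- Temporal formulas in conjunctive normal form

data Op : Set where
  □F □P □* : Op

OpSet : Set
OpSet = Op → Bool

_∈ᵒ_ : Op → OpSet → Set
O ∈ᵒ 𝒪 = T (𝒪 O)

Var : Set
Var = ℕᵇ

data Literal (𝒪 : OpSet) : Set where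
  ⊥ˡ  : Literal 𝒪
  var : Var → Literal 𝒪
  box : (O : Op) → .(O ∈ᵒ 𝒪) → Var → Literal 𝒪

-- The disjunction of the negations of the literals in `neg` and of the
-- literals in `pos`; repeated literals count repeatedly.
record Clause (𝒪 : OpSet) : Set where
  constructor clause
  field
    neg pos : List (Literal 𝒪)
open Clause public

-- Ψ ∧ □* Φ, where Ψ is a conjunction of variables and Φ one of clauses.
record Formula (𝒪 : OpSet) : Set where
  constructor formula
  field
    Ψ : List Var
    Φ : List (Clause 𝒪)
open Formula public

module _ {𝒪 : OpSet} where

  literalVars : Literal 𝒪 → List Var
  literalVars ⊥ˡ          = []
  literalVars (var x)     = [ x ]
  literalVars (box _ _ x) = [ x ]

  clauseVars : Clause 𝒪 → List Var
  clauseVars C = concatMap literalVars (neg C ++ pos C)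

  Vars : Formula 𝒪 → List Var
  Vars φ = Ψ φ ++ concatMap clauseVars (Φ φ)

  false-clause : Clause 𝒪
  false-clause = clause [] [ ⊥ˡ ]

  true-clause : Clause 𝒪
  true-clause = clause [ ⊥ˡ ] []

------------------------------------------------------------------------
-- Assignments and reducts

-- Partial functions; the intended domains are X ∪ {O x | x ∈ X, O ∈ 𝒪}.
Assignment : OpSet → Set
Assignment 𝒪 = Literal 𝒪 → Maybe Bool

isTrue isFalse : Maybe Bool → Bool
isTrue  = maybe′ id false
isFalse = maybe′ not false

module _ {𝒪 : OpSet} where

  InDomain : List Var → Literal 𝒪 → Set
  InDomain X ⊥ˡ          = ⊥
  InDomain X (var x)     = x ∈ X
  InDomain X (box _ _ x) = x ∈ X

  record ConsistentOn (X : List Var) (θ : Assignment 𝒪) : Set where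
    field
      domain : ∀ l → Is-just (θ l) ⇔ InDomain X l
      here   : ∀ (a : □* ∈ᵒ 𝒪) x → θ (box □* a x) ≡ just true →
               θ (var x) ≡ just true
      past   : ∀ (a : □* ∈ᵒ 𝒪) (p : □P ∈ᵒ 𝒪) x → θ (box □* a x) ≡ just true →
               θ (box □P p x) ≡ just true
      future : ∀ (a : □* ∈ᵒ 𝒪) (p : □F ∈ᵒ 𝒪) x → θ (box □* a x) ≡ just true →
               θ (box □F p x) ≡ just true

  satisfied : Assignment 𝒪 → Clause 𝒪 → Bool
  satisfied θ C = any (isFalse ∘ θ) (neg C) ∨ any (isTrue ∘ θ) (pos C)

  emptyToFalse : Clause 𝒪 → Clause 𝒪
  emptyToFalse (clause [] []) = false-clause
  emptyToFalse C              = C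

  emptyToTrue : List (Clause 𝒪) → List (Clause 𝒪)
  emptyToTrue [] = [ true-clause ]
  emptyToTrue Cs = Cs

  deleteFalsified : Assignment 𝒪 → Clause 𝒪 → Clause 𝒪
  deleteFalsified θ (clause ns ps) =
    clause (filterᵇ (not ∘ isTrue ∘ θ) ns) (filterᵇ (not ∘ isFalse ∘ θ) ps)

  _[_]ʳ : Formula 𝒪 → Assignment 𝒪 → Formula 𝒪
  formula Ψ Φ [ θ ]ʳ =
    formula Ψ (emptyToTrue (map (emptyToFalse ∘ deleteFalsified θ)
                                (filterᵇ (not ∘ satisfied θ) Φ)))

  Tautological : Clause 𝒪 → Set
  Tautological C = ∀ θ → ConsistentOn (clauseVars C) θ → T (satisfied θ C)

  -- Side conditions on input formulas; reducts need not satisfy `initial`.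
  --
  -- Clauses are by convention not tautological, as usual for clausal normal
  -- forms.  The convention matters: with the clauses ⋁_{x ∈ S} (x ∨ ¬ x) (or
  -- ⋁_{x ∈ S} (x ∨ ¬ □* x)) for the sets S, |S| ≥ 2, of a hypergraph, the
  -- strong KROM-backdoors would be exactly the hitting sets of the
  -- hypergraph, so that detecting them would be W[2]-hard.
  record LTL-CNF (φ : Formula 𝒪) : Set where
    field
      initial        : Ψ φ ⊆ concatMap clauseVars (Φ φ)
      nontautologous : All (¬_ ∘ Tautological) (Φ φ)

------------------------------------------------------------------------
-- Backdoors

Class : OpSet → Set₁
Class 𝒪 = Formula 𝒪 → Set

KROM : ∀ {𝒪} → Class 𝒪
KROM φ = All (λ C → length (neg C) + length (pos C) ≤ 2) (Φ φ)

-- X is a finite set, listed without repetitions.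
record StrongBackdoor {𝒪} (𝒞 : Class 𝒪) (φ : Formula 𝒪) (X : List Var) : Set where
  field
    distinct : Unique X
    within   : X ⊆ Vars φ
    reducts  : ∀ θ → ConsistentOn X θ → 𝒞 (φ [ θ ]ʳ)

------------------------------------------------------------------------
-- The detection problem

codeOp : Op → Tree
codeOp □F = nil
codeOp □P = cons nil nil
codeOp □* = cons nil (cons nil nil)

codeLiteral : ∀ {𝒪} → Literal 𝒪 → Tree
codeLiteral ⊥ˡ          = nil
codeLiteral (var x)     = cons nil (codeᵇ x)
codeLiteral (box O _ x) = cons (cons nil (codeOp O)) (codeᵇ x)

codeClause : ∀ {𝒪} → Clause 𝒪 → Tree
codeClause (clause ns ps) = cons (codeList codeLiteral ns) (codeList codeLiteral ps)

codeFormula : ∀ {𝒪} → Formula 𝒪 → Tree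
codeFormula (formula Ψ Φ) = cons (codeList codeᵇ Ψ) (codeList codeClause Φ)

record DetectInstance (𝒪 : OpSet) : Set where
  field
    φ     : Formula 𝒪
    isCNF : LTL-CNF φ
    k     : ℕ

Detect : (𝒪 : OpSet) → Class 𝒪 → SearchProblem
Detect 𝒪 𝒞 = record
  { Instance   = DetectInstance 𝒪
  ; Candidate  = List Var
  ; codeIn     = λ I → cons (codeFormula (φ I)) (codeℕ (k I))
  ; codeOut    = codeList codeᵇ
  ; parameter  = k
  ; IsSolution = λ I X → StrongBackdoor 𝒞 (φ I) X × length X ≤ k I
  }
  where open DetectInstance

{-# OPTIONS --safe #-}

-- A clause is not tautological, so some consistent assignment on its variables
-- falsifies it; restricted to the variables in X and extended by false, it
-- still does not satisfy the clause.  Hence X is a strong KROM-backdoor exactly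
-- if every clause has at most two literals not mentioning X, i.e. if X hits
-- every triple of literals of a clause.  While some clause has three literals
-- left, one of them must be hit: branch over the three and delete the literals
-- mentioning the chosen variable.  This search tree has depth at most k, and
-- the work at each node is quadratic.
module Submission where

open import Defs
open import Data.Bool using (Bool; true; false; T; not; _∨_; _∧_; if_then_else_)
open import Data.Bool.ListAction using (any)
open import Data.Bool.Properties using (T?; T-≡)
open import Data.Empty using (⊥; ⊥-elim)
open import Data.Fin using (Fin; zero; #_)
open import Data.List using (List; []; _∷_; _++_; map; length; filterᵇ)
open import Data.List.Membership.Propositional as Membership using (_∈_; lose)
open import Data.List.Membership.Propositional.Properties using (∈-filter⁺; ∈-filter⁻; ∈-concatMap⁺; ∈-++⁺ˡ; ∈-++⁺ʳ)
open import Data.List.Properties using (filter-++; length-++)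
open import Data.List.Relation.Unary.All as All using (All; []; _∷_)
import Data.List.Relation.Unary.All.Properties as All
open import Data.List.Relation.Unary.AllPairs using ([]; _∷_)
open import Data.List.Relation.Unary.Any as Any using (Any; here; there)
import Data.List.Relation.Unary.Any.Properties as Any
open import Data.List.Relation.Unary.Unique.Propositional using (Unique)
open import Data.Maybe as Maybe using (Maybe; just; nothing; Is-just; _<∣>_)
open import Data.Maybe.Relation.Unary.Any using (just)
open import Data.Nat using (ℕ; zero; suc; _+_; _*_; _^_; _≤_; _<_; z≤n; s≤s; s≤s⁻¹; _≤?_; _<?_)
open import Data.Nat.Binary as Binary using (ℕᵇ; zero; 2[1+_]; 1+[2_]; double; fromℕ'; toℕ)
open import Data.Nat.Binary.Properties using (_≟_; fromℕ≡fromℕ'; fromℕ-toℕ; toℕ-fromℕ'; 2[1+_]-double-suc)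
open import Data.Nat.Properties
  using (≤-trans; ≤-refl; ≤-reflexive; m≤n⇒m≤1+n; +-mono-≤; ≤ᵇ⇒≤; m≤m+n; m≤n+m; *-monoʳ-≤; *-monoˡ-≤;
         *-mono-≤; *-identityʳ; +-monoˡ-≤; +-monoʳ-≤; ^-monoˡ-≤; ^-distribˡ-+-*; m≤n⇒∃[o]m+o≡n; module ≤-Reasoning)
open import Data.Nat.Tactic.RingSolver using (solve-∀)
open import Data.Product using (_×_; _,_; proj₁; proj₂; ∃-syntax)
open import Data.Sum using (_⊎_; inj₁; inj₂)
open import Data.Unit using (tt)
open import Data.Vec using (Vec; []; _∷_; lookup)
open import Function using (_∘_; mk⇔; module Equivalence)
open import Relation.Binary.PropositionalEquality using (_≡_; refl; sym; trans; cong; subst; subst₂; _≢_)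
open import Relation.Nullary using (¬_; yes; no; does; contradiction)
open import Relation.Nullary.Decidable using (True; dec-true)

-- Signs and operators do not matter for hitting: an assignment on `X` fixes every `O x` with `x` in
-- `X`, so one argument serves all operator sets and the search works on flattened lists of
-- literals. Conversely, a consistent assignment that does not satisfy a clause falsifies, and so
-- deletes, each of its hit literals; hence only unhit literals can keep a reduct out of KROM. That
-- a clause is not tautological is a negated universal statement and yields no falsifying assignment
-- to compute with, so the bound on unhit literals is proved by contradiction. The parameter is
-- given in binary, whereas the recursion strips a unary counter; building that counter takes time
-- depending on `k` alone. The bound `fuel k`, which is `2 * 4 ^ k - 1`, grows by a factor above
-- four per level although only three branches are made: the surplus pays for the work at the node
-- itself.

-- Filtered lists and Boolean quantifiers

module _ {A : Set} where

  filterᵇ-cong : {p q : A → Bool} → (∀ x → p x ≡ q x) → ∀ xs → filterᵇ p xs ≡ filterᵇ q xs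
  filterᵇ-cong         p≗q []       = refl
  filterᵇ-cong {q = q} p≗q (x ∷ xs) rewrite p≗q x with q x
  ... | true  = cong (x ∷_) (filterᵇ-cong p≗q xs)
  ... | false = filterᵇ-cong p≗q xs

  filterᵇ-filterᵇ : (p q : A → Bool) → ∀ xs →
                    filterᵇ p (filterᵇ q xs) ≡ filterᵇ (λ x → q x ∧ p x) xs
  filterᵇ-filterᵇ p q []       = refl
  filterᵇ-filterᵇ p q (x ∷ xs) with q x
  ... | false = filterᵇ-filterᵇ p q xs
  ... | true  with p x
  ...   | true  = cong (x ∷_) (filterᵇ-filterᵇ p q xs)
  ...   | false = filterᵇ-filterᵇ p q xs

  length-filterᵇ-mono : {p q : A → Bool} {xs : List A} →
                        All (λ x → T (p x) → T (q x)) xs →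
                        length (filterᵇ p xs) ≤ length (filterᵇ q xs)
  length-filterᵇ-mono                     []               = z≤n
  length-filterᵇ-mono {p} {q} {x ∷ xs} (p⇒q ∷ ps⇒qs) with p x | q x
  ... | true  | true  = s≤s (length-filterᵇ-mono ps⇒qs)
  ... | true  | false = ⊥-elim (p⇒q tt)
  ... | false | true  = m≤n⇒m≤1+n (length-filterᵇ-mono ps⇒qs)
  ... | false | false = length-filterᵇ-mono ps⇒qs

  length-filterᵇ-≤ : (p : A → Bool) (xs : List A) → length (filterᵇ p xs) ≤ length xs
  length-filterᵇ-≤ p []       = z≤n
  length-filterᵇ-≤ p (x ∷ xs) with p x
  ... | true  = s≤s (length-filterᵇ-≤ p xs)
  ... | false = m≤n⇒m≤1+n (length-filterᵇ-≤ p xs)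

  any-false : (p : A → Bool) {xs : List A} → any p xs ≡ false → ∀ {x} → x ∈ xs → p x ≡ false
  any-false p {y ∷ ys} eq x∈ with p y in py | eq | x∈
  ... | true  | () | _
  ... | false | _  | here refl  = py
  ... | false | e  | there x∈ys = any-false p e x∈ys

  any-false⁻ : (p : A → Bool) {xs : List A} → (∀ {x} → x ∈ xs → p x ≡ false) → any p xs ≡ false
  any-false⁻ p {[]}     h = refl
  any-false⁻ p {x ∷ xs} h rewrite h (here refl) = any-false⁻ p (h ∘ there)

-- The branching algorithm

module _ {𝒪 : OpSet} where

  private
    Lit = Literal 𝒪

  -- The operator is ignored because choosing `x` puts `x` and all `O x` into the domain of the
  -- assignment at once.
  mentions : Var → Lit → Bool
  mentions x ⊥ˡ          = false
  mentions x (var y)     = does (x ≟ y)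
  mentions x (box _ _ y) = does (x ≟ y)

  hit : List Var → Lit → Bool
  hit X l = any (λ x → mentions x l) X

  unhit : List Var → List Lit → List Lit
  unhit X = filterᵇ (not ∘ hit X)

  delete : Var → List Lit → List Lit
  delete x = filterᵇ (not ∘ mentions x)

  Covers : List Var → List (List Lit) → Set
  Covers X = All (λ C → length (unhit X C) ≤ 2)

  find : List (List Lit) → Maybe (Lit × Lit × Lit)
  find []                        = nothing
  find ((a ∷ b ∷ c ∷ _) ∷ Cs)    = just (a , b , c)
  find ([]              ∷ Cs)    = find Cs
  find ((_ ∷ [])        ∷ Cs)    = find Cs
  find ((_ ∷ _ ∷ [])    ∷ Cs)    = find Cs

  module _ (rec : List (List Lit) → Maybe (List Var)) (Cs : List (List Lit)) where
    branchOn : Var → Maybe (List Var)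
    branchOn x = Maybe.map (x ∷_) (rec (map (delete x) Cs))

    branch : Lit → Maybe (List Var)
    -- No variable occurs in `⊥ˡ`, so this literal can never be hit and the branch is dead.
    branch ⊥ˡ          = nothing
    branch (var x)     = branchOn x
    branch (box _ _ x) = branchOn x

    branches : Lit × Lit × Lit → Maybe (List Var)
    branches (a , b , c) = branch a <∣> branch b <∣> branch c

  mutual
    search : ℕ → List (List Lit) → Maybe (List Var)
    search k Cs = continue k Cs (find Cs)

    -- Taking the result of `find` as an argument lets proofs abstract over it, while the recursion
    -- stays structural in the depth. Depth zero fails only after a triple has been found.
    continue : ℕ → List (List Lit) → Maybe (Lit × Lit × Lit) → Maybe (List Var)
    continue _       Cs nothing  = just []
    continue zero    Cs (just _) = nothing
    continue (suc k) Cs (just t) = branches (search k) Cs t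

  -- Soundness and completeness of the search

  Occurs : Var → List (List Lit) → Set
  Occurs x = Any (Any (T ∘ mentions x))

  mentions-var : ∀ x → T (mentions x (var x))
  mentions-var x rewrite dec-true (x ≟ x) refl = tt

  find-nothing : ∀ Cs → find Cs ≡ nothing → All (λ C → length C ≤ 2) Cs
  find-nothing []                     eq = []
  find-nothing ([]              ∷ Cs) eq = z≤n ∷ find-nothing Cs eq
  find-nothing ((_ ∷ [])        ∷ Cs) eq = s≤s z≤n ∷ find-nothing Cs eq
  find-nothing ((_ ∷ _ ∷ [])    ∷ Cs) eq = s≤s (s≤s z≤n) ∷ find-nothing Cs eq
  find-nothing ((_ ∷ _ ∷ _ ∷ _) ∷ Cs) ()

  find-just : ∀ Cs {a b c} → find Cs ≡ just (a , b , c) → ∃[ ls ] (a ∷ b ∷ c ∷ ls) ∈ Cs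
  find-just ((_ ∷ _ ∷ _ ∷ ls) ∷ Cs) refl = ls , here refl
  find-just ([]              ∷ Cs) eq with ls , C∈ ← find-just Cs eq = ls , there C∈
  find-just ((_ ∷ [])        ∷ Cs) eq with ls , C∈ ← find-just Cs eq = ls , there C∈
  find-just ((_ ∷ _ ∷ [])    ∷ Cs) eq with ls , C∈ ← find-just Cs eq = ls , there C∈

  -- The invariant of the recursion: deleting a variable early and counting it as chosen leave the
  -- same literals. Being an equation, it serves soundness and completeness alike.
  unhit-delete : ∀ x X C → unhit X (delete x C) ≡ unhit (x ∷ X) C
  unhit-delete x X C = trans (filterᵇ-filterᵇ (not ∘ hit X) (not ∘ mentions x) C)
                             (filterᵇ-cong pointwise C)
    where
    pointwise : ∀ l → not (mentions x l) ∧ not (hit X l) ≡ not (hit (x ∷ X) l)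
    pointwise l with mentions x l
    ... | true  = refl
    ... | false = refl

  covers-delete⁻ : ∀ x X {Cs} → Covers X (map (delete x) Cs) → Covers (x ∷ X) Cs
  covers-delete⁻ x X = All.map (λ {C} → subst (λ D → length D ≤ 2) (unhit-delete x X C)) ∘ All.map⁻

  covers-delete⁺ : ∀ x X {Cs} → Covers (x ∷ X) Cs → Covers X (map (delete x) Cs)
  covers-delete⁺ x X = All.map⁺ ∘ All.map (λ {C} → subst (λ D → length D ≤ 2) (sym (unhit-delete x X C)))

  -- Only the predicate `hit` matters for covering, so one occurrence of `x` is pulled out of the
  -- list up to equality of `hit` instead of a permutation.
  toFront : ∀ {x X} → x ∈ X → ∃[ Y ] suc (length Y) ≡ length X × (∀ l → hit X l ≡ hit (x ∷ Y) l)
  toFront {X = _ ∷ Y} (here refl) = Y , refl , λ _ → refl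
  toFront {x} {X = y ∷ _} (there x∈) with Y , len , eq ← toFront x∈ =
    y ∷ Y , cong suc len , λ l → trans (cong (mentions y l ∨_) (eq l)) (swap (mentions y l) (mentions x l) (hit Y l))
    where
    swap : ∀ a b c → a ∨ (b ∨ c) ≡ b ∨ (a ∨ c)
    swap false _     _ = refl
    swap true  false _ = refl
    swap true  true  _ = refl

  covers-cong : ∀ X Y {Cs} → (∀ l → hit X l ≡ hit Y l) → Covers X Cs → Covers Y Cs
  covers-cong X Y eq = All.map (λ {C} → subst (λ D → length D ≤ 2) (filterᵇ-cong (cong not ∘ eq) C))

  occurs-delete : ∀ {x y} Cs → Occurs y (map (delete x) Cs) → Occurs y Cs × x ≢ y
  occurs-delete {x} {y} Cs o = Any.map (Any.filter⁻ _) o′ ,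
    λ { refl → absurd (proj₁ (Any.satisfied o′)) (proj₂ (Any.satisfied o′)) }
    where
    o′ : Any (Any (T ∘ mentions y) ∘ delete x) Cs
    o′ = Any.map⁻ o

    absurd : ∀ C → ¬ Any (T ∘ mentions x) (delete x C)
    absurd []      ()
    absurd (l ∷ C) p with mentions x l in eq
    ... | true  = absurd C p
    ... | false with p
    ...   | here q   = subst T eq q
    ...   | there p′ = absurd C p′

  module _ {rec : List (List Lit) → Maybe (List Var)} {Cs : List (List Lit)} where

    branch-just : ∀ l {X} → branch rec Cs l ≡ just X →
                  ∃[ x ] ∃[ Y ] X ≡ x ∷ Y × T (mentions x l) × rec (map (delete x) Cs) ≡ just Y
    branch-just (var x) eq with rec (map (delete x) Cs) in r | eq
    ... | just Y  | refl = x , Y , refl , mentions-var x , r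
    ... | nothing | ()
    branch-just (box O a x) eq with rec (map (delete x) Cs) in r | eq
    ... | just Y  | refl = x , Y , refl , mentions-var x , r
    ... | nothing | ()

    branches-just : ∀ a b c {X} → branches rec Cs (a , b , c) ≡ just X → ∀ {ls} →
                    ∃[ x ] ∃[ Y ] X ≡ x ∷ Y × Any (T ∘ mentions x) (a ∷ b ∷ c ∷ ls) ×
                                  rec (map (delete x) Cs) ≡ just Y
    branches-just a b c eq with branch rec Cs a in ra
    branches-just a b c refl | just X
      with x , Y , e , m , r ← branch-just a ra = x , Y , e , here m , r
    branches-just a b c eq | nothing with branch rec Cs b in rb
    branches-just a b c refl | nothing | just X
      with x , Y , e , m , r ← branch-just b rb = x , Y , e , there (here m) , r
    branches-just a b c eq | nothing | nothing
      with x , Y , e , m , r ← branch-just c eq = x , Y , e , there (there (here m)) , r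

    branchOn-nothing : ∀ x → branchOn rec Cs x ≡ nothing → rec (map (delete x) Cs) ≡ nothing
    branchOn-nothing x eq with rec (map (delete x) Cs) | eq
    ... | nothing | _  = refl
    ... | just _  | ()

    branch-nothing : ∀ l {x} → T (mentions x l) → branch rec Cs l ≡ nothing →
                     rec (map (delete x) Cs) ≡ nothing
    branch-nothing (var y) {x} m eq with x ≟ y
    ... | yes refl = branchOn-nothing x eq
    branch-nothing (box _ _ y) {x} m eq with x ≟ y
    ... | yes refl = branchOn-nothing x eq

    branches-nothing : ∀ a b c {x} → branches rec Cs (a , b , c) ≡ nothing →
                       T (mentions x a) ⊎ T (mentions x b) ⊎ T (mentions x c) →
                       rec (map (delete x) Cs) ≡ nothing
    branches-nothing a b c eq m with branch rec Cs a in ra | eq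
    ... | just _  | ()
    ... | nothing | eq′ with branch rec Cs b in rb | eq′
    ...   | just _  | ()
    ...   | nothing | rc with m
    ...     | inj₁ m′        = branch-nothing a m′ ra
    ...     | inj₂ (inj₁ m′) = branch-nothing b m′ rb
    ...     | inj₂ (inj₂ m′) = branch-nothing c m′ rc

  -- `occur` serves twice: it places the answer inside `Vars φ`, and, since nothing mentioning the
  -- chosen variable survives `delete`, it separates that variable from those found deeper, which
  -- gives `unique`.
  record Sound (k : ℕ) (Cs : List (List Lit)) (X : List Var) : Set where
    field
      occur   : All (λ x → Occurs x Cs) X
      unique  : Unique X
      bounded : length X ≤ k
      covers  : Covers X Cs

  search-just : ∀ k Cs {X} → search k Cs ≡ just X → Sound k Cs X
  search-just k Cs eq with find Cs in fd
  search-just k Cs refl | nothing = record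
    { occur = [] ; unique = [] ; bounded = z≤n
    ; covers = All.map (λ {C} → ≤-trans (length-filterᵇ-≤ _ C)) (find-nothing Cs fd) }
  search-just (suc k) Cs eq | just (a , b , c)
    with ls , C∈ ← find-just Cs fd
    with x , Y , refl , m , r ← branches-just {search k} {Cs} a b c eq {ls} = record
    { occur   = lose C∈ m ∷ All.map proj₁ occ
    ; unique  = All.map proj₂ occ ∷ unique
    ; bounded = s≤s bounded
    ; covers  = covers-delete⁻ x Y covers }
    where
    open Sound (search-just k (map (delete x) Cs) r)
    occ = All.map (occurs-delete Cs) occur

  hit-triple : ∀ X a b c {ls} → length (unhit X (a ∷ b ∷ c ∷ ls)) ≤ 2 →
               T (hit X a) ⊎ T (hit X b) ⊎ T (hit X c)
  hit-triple X a b c le with hit X a | le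
  ... | true  | _  = inj₁ tt
  ... | false | le′ with hit X b | le′
  ...   | true  | _   = inj₂ (inj₁ tt)
  ...   | false | le″ with hit X c | le″
  ...     | true  | _            = inj₂ (inj₂ tt)
  ...     | false | s≤s (s≤s ())

  -- A covering `X` contains a variable of one of the three literals. Split off from `X`, it leaves
  -- a shorter list that covers the input of that branch, so the branch could not have failed.
  search-nothing : ∀ k Cs → search k Cs ≡ nothing → ∀ X → length X ≤ k → ¬ Covers X Cs
  search-nothing k Cs eq X le cov with find Cs in fd | eq
  ... | nothing | ()
  search-nothing k Cs eq X le cov | just (a , b , c) | eq′
    with ls , C∈ ← find-just Cs fd = go k X le cov eq′ (hitter (hit-triple X a b c {ls} (All.lookup cov C∈)))
    where
    Mentions : Var → Set
    Mentions x = T (mentions x a) ⊎ T (mentions x b) ⊎ T (mentions x c)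

    member : ∀ l → T (hit X l) → ∃[ x ] x ∈ X × T (mentions x l)
    member l h = Membership.find (Any.any⁻ (λ x → mentions x l) X h)

    hitter : T (hit X a) ⊎ T (hit X b) ⊎ T (hit X c) → ∃[ x ] x ∈ X × Mentions x
    hitter (inj₁ h)        with x , x∈ , m ← member a h = x , x∈ , inj₁ m
    hitter (inj₂ (inj₁ h)) with x , x∈ , m ← member b h = x , x∈ , inj₂ (inj₁ m)
    hitter (inj₂ (inj₂ h)) with x , x∈ , m ← member c h = x , x∈ , inj₂ (inj₂ m)

    go : ∀ k X → length X ≤ k → Covers X Cs → continue k Cs (just (a , b , c)) ≡ nothing →
         (∃[ x ] x ∈ X × Mentions x) → ⊥
    go zero    []      le cov eq (x , () , _)
    go (suc k) X       le cov eq (x , x∈ , m) with Y , len , same ← toFront x∈ =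
      search-nothing k (map (delete x) Cs) (branches-nothing a b c eq m) Y
        (s≤s⁻¹ (subst (_≤ suc k) (sym len) le))
        (covers-delete⁺ x Y (covers-cong X (x ∷ Y) same cov))

  -- Strong KROM-backdoors

  literals : Clause 𝒪 → List Lit
  literals C = neg C ++ pos C

  mentions⇒∈ : ∀ {x} l → T (mentions x l) → x ∈ literalVars l
  mentions⇒∈ {x} (var y)     m with yes refl ← x ≟ y = here refl
  mentions⇒∈ {x} (box _ _ y) m with yes refl ← x ≟ y = here refl

  occurs⇒∈Vars : ∀ φ {x} → Occurs x (map literals (Φ φ)) → x ∈ Vars φ
  occurs⇒∈Vars φ o = ∈-++⁺ʳ (Ψ φ) (∈-concatMap⁺ clauseVars
    (Any.map (λ {C} → ∈-concatMap⁺ literalVars ∘ Any.map (λ {l} → mentions⇒∈ l)) (Any.map⁻ o)))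

  hit⇒InDomain : ∀ X l → T (hit X l) → InDomain X l
  hit⇒InDomain X l h with x , x∈ , m ← Membership.find (Any.any⁻ (λ x → mentions x l) X h) = go l m
    where
    go : ∀ l → T (mentions x l) → InDomain X l
    go (var y)     m with yes refl ← x ≟ y = x∈
    go (box _ _ y) m with yes refl ← x ≟ y = x∈

  InDomain⇒hit : ∀ X l → InDomain X l → T (hit X l)
  InDomain⇒hit X (var y)     y∈ = Any.any⁺ _ (lose y∈ (mentions-var y))
  InDomain⇒hit X (box _ _ y) y∈ = Any.any⁺ _ (lose y∈ (mentions-var y))

  width : Clause 𝒪 → ℕ
  width C = length (neg C) + length (pos C)

  length-unhit : ∀ X C → length (unhit X (literals C)) ≡ length (unhit X (neg C)) + length (unhit X (pos C))
  length-unhit X C = trans (cong length (filter-++ _ (neg C) (pos C))) (length-++ (unhit X (neg C)))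

  -- Replacing an empty clause by false raises its width from 0 to 1 and the empty formula becomes a
  -- clause of width 1; both stay within 2, so these conventions do not affect membership in KROM.
  width-emptyToFalse : ∀ C → width C ≤ 2 → width (emptyToFalse C) ≤ 2
  width-emptyToFalse (clause []      [])      w = s≤s z≤n
  width-emptyToFalse (clause []      (_ ∷ _)) w = w
  width-emptyToFalse (clause (_ ∷ _) _)       w = w

  width-emptyToFalse⁻ : ∀ C → width (emptyToFalse C) ≤ 2 → width C ≤ 2
  width-emptyToFalse⁻ (clause []      [])      w = z≤n
  width-emptyToFalse⁻ (clause []      (_ ∷ _)) w = w
  width-emptyToFalse⁻ (clause (_ ∷ _) _)       w = w

  emptyToTrue⁺ : ∀ Cs → All (λ C → width C ≤ 2) Cs → All (λ C → width C ≤ 2) (emptyToTrue Cs)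
  emptyToTrue⁺ []       _  = s≤s z≤n ∷ []
  emptyToTrue⁺ (_ ∷ _) ws = ws

  emptyToTrue⁻ : ∀ Cs → All (λ C → width C ≤ 2) (emptyToTrue Cs) → All (λ C → width C ≤ 2) Cs
  emptyToTrue⁻ []      _  = []
  emptyToTrue⁻ (_ ∷ _) ws = ws

  unsatisfied : ∀ (θ : Assignment 𝒪) C → T (not (satisfied θ C)) →
                (∀ {l} → l ∈ neg C → isFalse (θ l) ≡ false) ×
                (∀ {l} → l ∈ pos C → isTrue (θ l) ≡ false)
  unsatisfied θ C u with any (isFalse ∘ θ) (neg C) in n | any (isTrue ∘ θ) (pos C) in p
  ... | false | false = any-false (isFalse ∘ θ) n , any-false (isTrue ∘ θ) p

  -- A hit literal lies in the domain of `θ`. In a clause that `θ` does not satisfy, its value must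
  -- falsify it, so it is deleted; whatever remains is unhit.
  falsified⇒unhit : ∀ {X θ} → ConsistentOn X θ → ∀ C → T (not (satisfied θ C)) →
                    width (deleteFalsified θ C) ≤ length (unhit X (literals C))
  falsified⇒unhit {X} {θ} con C@(clause ns ps) u with n , p ← unsatisfied θ C u =
    ≤-trans (+-mono-≤ (length-filterᵇ-mono (All.tabulate λ {l} l∈ → onNeg l (n l∈)))
                      (length-filterᵇ-mono (All.tabulate λ {l} l∈ → onPos l (p l∈))))
            (≤-reflexive (sym (length-unhit X C)))
    where
    open ConsistentOn con
    onNeg : ∀ l → isFalse (θ l) ≡ false → T (not (isTrue (θ l))) → T (not (hit X l))
    onNeg l f t with hit X l in h
    ... | false = tt
    ... | true with θ l | Equivalence.from (domain l) (hit⇒InDomain X l (subst T (sym h) tt)) | f | t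
    ...   | just false | _ | () | _
    ...   | just true  | _ | _  | ()
    onPos : ∀ l → isTrue (θ l) ≡ false → T (not (isFalse (θ l))) → T (not (hit X l))
    onPos l t f with hit X l in h
    ... | false = tt
    ... | true with θ l | Equivalence.from (domain l) (hit⇒InDomain X l (subst T (sym h) tt)) | f | t
    ...   | just false | _ | () | _
    ...   | just true  | _ | _  | ()

  covers⇒reduct : ∀ {X} φ → Covers X (map literals (Φ φ)) → ∀ θ → ConsistentOn X θ → KROM (φ [ θ ]ʳ)
  covers⇒reduct (formula _ Φ) cov θ con = emptyToTrue⁺ _ (All.map⁺ (All.tabulate λ {C} C∈ →
    let C∈Φ , unsat = ∈-filter⁻ (T? ∘ not ∘ satisfied θ) {xs = Φ} C∈ in
    width-emptyToFalse (deleteFalsified θ C)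
      (≤-trans (falsified⇒unhit con C unsat) (All.lookup (All.map⁻ cov) C∈Φ))))

  -- Variables of X on which θ is undefined get the value false: isTrue nothing = false.
  transfer : List Var → Assignment 𝒪 → Assignment 𝒪
  transfer X θ l = if hit X l then just (isTrue (θ l)) else nothing

  -- Each condition relates two literals of the same variable, on which `hit X` agrees by
  -- computation, so both survive the restriction or neither does. Where `θ` is undefined, the
  -- default false makes the premise fail.
  transfer-consistent : ∀ X {Y θ} → ConsistentOn Y θ → ConsistentOn X (transfer X θ)
  transfer-consistent X {Y} {θ} con = record
    { domain = λ l → mk⇔ (to l) (from l)
    ; here   = λ a x → implied (box □* a x) (var x) refl (C.here a x)
    ; past   = λ a p x → implied (box □* a x) (box □P p x) refl (C.past a p x)
    ; future = λ a p x → implied (box □* a x) (box □F p x) refl (C.future a p x)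
    }
    where
    module C = ConsistentOn con
    to : ∀ l → Is-just (transfer X θ l) → InDomain X l
    to l j with hit X l in h
    ... | true = hit⇒InDomain X l (subst T (sym h) tt)
    ... | false with () ← j
    from : ∀ l → InDomain X l → Is-just (transfer X θ l)
    from l d = subst (λ b → Is-just (if b then just (isTrue (θ l)) else nothing))
                     (sym (Equivalence.to T-≡ (InDomain⇒hit X l d))) (just tt)
    implied : ∀ l l′ → hit X l ≡ hit X l′ → (θ l ≡ just true → θ l′ ≡ just true) →
              transfer X θ l ≡ just true → transfer X θ l′ ≡ just true
    implied l l′ h imp eq with hit X l | hit X l′
    implied l l′ refl imp eq | true  | true with θ l | eq
    ... | just true | _ rewrite imp refl = refl
    ... | just false | ()
    ... | nothing | ()

  covers : ∀ {X} φ → LTL-CNF φ → (∀ θ → ConsistentOn X θ → KROM (φ [ θ ]ʳ)) → Covers X (map literals (Φ φ))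
  covers {X} φ@(formula _ Φ) cnf krom = All.map⁺ (All.tabulate bound)
    where
    module _ {C : Clause 𝒪} (C∈ : C ∈ Φ) (θ : Assignment 𝒪) (con : ConsistentOn (clauseVars C) θ)
             (unsat : T (not (satisfied θ C))) where

      θ′ = transfer X θ

      defined : ∀ {l} → l ∈ literals C → T (hit X l) → Is-just (θ l)
      defined {l} l∈ h = Equivalence.from (ConsistentOn.domain con l) (inClause l (hit⇒InDomain X l h) l∈)
        where
        inClause : ∀ l → InDomain X l → l ∈ literals C → InDomain (clauseVars C) l
        inClause (var y)     _ l∈ = ∈-concatMap⁺ literalVars (lose l∈ (here refl))
        inClause (box _ _ y) _ l∈ = ∈-concatMap⁺ literalVars (lose l∈ (here refl))

      neg-false : ∀ {l} → l ∈ neg C → isFalse (θ′ l) ≡ false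
      neg-false {l} l∈ with hit X l in h
      ... | false = refl
      ... | true with θ l | defined (∈-++⁺ˡ l∈) (subst T (sym h) tt) | proj₁ (unsatisfied θ C unsat) l∈
      ...   | just true  | _ | _ = refl
      ...   | just false | _ | ()

      pos-false : ∀ {l} → l ∈ pos C → isTrue (θ′ l) ≡ false
      pos-false {l} l∈ with hit X l
      ... | false = refl
      ... | true with θ l | proj₂ (unsatisfied θ C unsat) l∈
      ...   | just true  | ()
      ...   | just false | _ = refl
      ...   | nothing    | _ = refl

      unsat′ : T (not (satisfied θ′ C))
      unsat′ rewrite any-false⁻ (isFalse ∘ θ′) neg-false | any-false⁻ (isTrue ∘ θ′) pos-false = tt

      narrow : width (deleteFalsified θ′ C) ≤ 2
      narrow = width-emptyToFalse⁻ (deleteFalsified θ′ C) (All.lookup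
        (All.map⁻ (emptyToTrue⁻ _ (krom θ′ (transfer-consistent X con))))
        (∈-filter⁺ (T? ∘ not ∘ satisfied θ′) C∈ unsat′))

      unhit-≤ : length (unhit X (literals C)) ≤ width (deleteFalsified θ′ C)
      unhit-≤ = ≤-trans (≤-reflexive (length-unhit X C))
        (+-mono-≤ (length-filterᵇ-mono {xs = neg C} (All.tabulate λ {l} _ → undef (not ∘ isTrue) tt l))
                  (length-filterᵇ-mono {xs = pos C} (All.tabulate λ {l} _ → undef (not ∘ isFalse) tt l)))
        where
        undef : (f : Maybe Bool → Bool) → T (f nothing) → ∀ l → T (not (hit X l)) → T (f (θ′ l))
        undef f fn l h with hit X l
        ... | false = fn

    bound : ∀ {C} → C ∈ Φ → length (unhit X (literals C)) ≤ 2
    -- The bound is decidable, which permits the proof by contradiction: were it violated, any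
    -- consistent `θ` not satisfying `C` would give a reduct outside KROM, so every `θ` would
    -- satisfy `C`.
    bound {C} C∈ with length (unhit X (literals C)) ≤? 2
    ... | yes le = le
    ... | no  gt = contradiction tautological (All.lookup (LTL-CNF.nontautologous cnf) C∈)
      where
      tautological : Tautological C
      tautological θ con with satisfied θ C in s
      ... | true  = tt
      ... | false = gt (≤-trans (unhit-≤ C∈ θ con unsat) (narrow C∈ θ con unsat))
        where unsat = subst (T ∘ not) (sym s) tt

  solution : DetectInstance 𝒪 → Maybe (List Var)
  solution I = search k (map literals (Φ φ)) where open DetectInstance I

  solution-correct : ∀ I → SearchProblem.Answers (Detect 𝒪 KROM) I (solution I)
  solution-correct I with solution I in eq
  ... | just X  = record
    { distinct = unique
    ; within   = λ x∈ → occurs⇒∈Vars φ (All.lookup occur x∈)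
    ; reducts  = covers⇒reduct φ cover
    } , bounded
    where
    open DetectInstance I
    open Sound (search-just k (map literals (Φ φ)) eq) renaming (covers to cover)
  ... | nothing = λ X (backdoor , X≤k) →
    search-nothing k (map literals (Φ φ)) eq X X≤k
      (covers φ isCNF (StrongBackdoor.reducts backdoor))
    where open DetectInstance I

-- Cost polynomials are compared by exhibiting their difference.
m≤m+slack : ∀ {m n} d → m + d ≡ n → m ≤ n
m≤m+slack {m} d refl = m≤m+n m d

-- The search program

private
  v : ∀ {m n} i {i<n : True (i <? n)} → Exp m n
  v i {i<n} = ref (#_ i {m<n = i<n})

  one : ∀ {m n} → Exp m n
  one = cons nil nil

  double# unary# append# flat# eq# delete# deleteAll# find# search# branch# : Fin 11
  double#    = # 1
  unary#     = # 2
  append#    = # 3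
  flat#      = # 4
  eq#        = # 5
  delete#    = # 6
  deleteAll# = # 7
  find#      = # 8
  search#    = # 9
  branch#    = # 10

-- Several arguments are passed as a right-nested pair: xs , ys for append;
-- x , y for eq; a variable and a list of literals (clauses) for delete
-- (deleteAll); fuel and clauses for search; a literal, fuel and clauses for
-- branch.  The results of find, search and branch are coded by codeMaybe.
doubleBody unaryBody appendBody flatBody eqBody deleteBody deleteAllBody findBody searchBody branchBody
  mainBody fuelBody : Exp 11 1

doubleBody =
  case (v 0) nil
    (case (v 0)
      (cons nil (cons one (v 1)))
      (cons nil (call double# (v 3))))

unaryBody =
  case (v 0) (cons one nil)
    (case (v 0)
      -- The argument is counted down in binary: the predecessor of `2[1+ x ]` is `1+[2 x ]`, that
      -- of `1+[2 x ]` is `double x`.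
      (cons one (cons one (call unary# (cons one (v 1)))))
      (cons one (cons one (call unary# (call double# (v 3))))))

appendBody =
  case (v 0) nil
    (case (v 0) (v 1)
      (cons (v 0) (call append# (cons (v 1) (v 3)))))

flatBody =
  case (v 0) nil
    (cons (call append# (v 0)) (call flat# (v 1)))

eqBody =
  case (v 0) nil
    (case (v 0)
      (case (v 1) one nil)
      (case (v 3) nil
        (case (v 2)
          (case (v 0) (call eq# (cons (v 3) (v 1))) nil)
          (case (v 2) nil (call eq# (cons (v 7) (v 5)))))))

deleteBody =
  case (v 0) nil
    (case (v 1) nil
      (bind (call delete# (cons (v 2) (v 1)))
        -- `⊥ˡ` is coded by `nil` and is kept; any other literal has its variable as right subtree,
        -- whatever its tag.
        (case (v 1)
          (cons (v 1) (v 0))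
          (case (call eq# (cons (v 5) (v 1)))
            (cons (v 3) (v 2))
            (v 4)))))

deleteAllBody =
  case (v 0) nil
    (case (v 1) nil
      (cons (call delete# (cons (v 2) (v 0))) (call deleteAll# (cons (v 2) (v 1)))))

findBody =
  case (v 0) nil
    (case (v 0) (call find# (v 1))
      (case (v 1) (call find# (v 3))
        (case (v 1) (call find# (v 5))
          (cons nil (cons (v 4) (cons (v 2) (v 0)))))))

searchBody =
  case (v 0) nil
    (case (call find# (v 1)) (cons nil nil)
      (case (v 1) nil
        (case (v 1) nil
          -- The counter has an odd number of digits. A single remaining digit means depth zero;
          -- otherwise two digits are stripped.
          (case (v 6) nil
            (case (v 1) nil
              (bind (cons (v 1) (v 11))
                (case (call branch# (cons (v 7) (v 0)))
                  (case (call branch# (cons (v 5) (v 0)))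
                    (call branch# (cons (v 6) (v 0)))
                    (cons (v 0) (v 1)))
                  (cons (v 0) (v 1)))))))))

branchBody =
  case (v 0) nil
    (case (v 0) nil
      (case (v 3) nil
        (case (call search# (cons (v 0) (call deleteAll# (cons (v 3) (v 1)))))
          nil
          (cons nil (cons (v 5) (v 1))))))

mainBody =
  case (v 0) nil
    (case (v 0) nil
      (call search# (cons (call unary# (v 3)) (call flat# (v 1)))))

fuelBody = call unary# (v 0)

bodiesWith : Exp 11 1 → Vec (Exp 11 1) 11
bodiesWith main =
  main ∷ doubleBody ∷ unaryBody ∷ appendBody ∷ flatBody ∷ eqBody ∷ deleteBody ∷ deleteAllBody ∷
  findBody ∷ searchBody ∷ branchBody ∷ []

search-program fuel-program : Program
search-program = record { bodies = bodiesWith mainBody }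
fuel-program   = record { bodies = bodiesWith fuelBody }

-- Encodings, the depth counter and evaluation within a budget

codeBool : Bool → Tree
codeBool false = nil
codeBool true  = cons nil nil

codeAnswer : Maybe (List Var) → Tree
codeAnswer = codeMaybe (codeList codeᵇ)

-- The 2 n + 1 digits of fuelᵇ n are the counter of the search, two for each
-- unit of depth, and its value fuel n bounds the number of nodes: since
-- fuel (suc n) = 3 + 4 * fuel n, it absorbs the recurrence t (suc n) = a + 3 * t n.
-- Thus the program building the counter also computes the function f.
fuelᵇ : ℕ → ℕᵇ
fuelᵇ zero    = 1+[2 zero ]
fuelᵇ (suc n) = 1+[2 1+[2 fuelᵇ n ] ]

fuel : ℕ → ℕ
fuel n = toℕ (fuelᵇ n)

n<fuel : ∀ n → n < fuel n
n<fuel zero    = s≤s z≤n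
n<fuel (suc n) = s≤s (≤-trans (n<fuel n) (m≤m+slack (fuel n + 2 * (1 + fuel n)) (arith (fuel n))))
  where arith : ∀ f → f + (f + 2 * (1 + f)) ≡ 2 * suc (2 * f)
        arith = solve-∀

size>0 : ∀ t → 1 ≤ size t
size>0 nil        = ≤-refl
size>0 (cons _ _) = s≤s z≤n

size-∈ : ∀ {A : Set} (code : A → Tree) {x xs} → x ∈ xs → size (code x) ≤ size (codeList code xs)
size-∈ code (here refl)             = m≤n⇒m≤1+n (m≤m+n _ _)
size-∈ code {xs = y ∷ _} (there x∈) = m≤n⇒m≤1+n (≤-trans (size-∈ code x∈) (m≤n+m _ (size (code y))))

-- The true size is logarithmic, but a linear bound suffices: it is compared with `fuel`, which
-- grows exponentially.
size-codeᵇ : ∀ x → size (codeᵇ x) ≤ 1 + toℕ x * 4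
size-codeᵇ zero = s≤s z≤n
size-codeᵇ 2[1+ x ] = ≤-trans (+-mono-≤ (≤-refl {2}) (size-codeᵇ x)) (m≤m+slack (6 + toℕ x * 4) (arith (toℕ x)))
  where arith : ∀ n → 2 + (1 + n * 4) + (6 + n * 4) ≡ 1 + (2 * suc n) * 4
        arith = solve-∀
size-codeᵇ 1+[2 x ] = ≤-trans (+-mono-≤ (≤-refl {4}) (size-codeᵇ x)) (m≤m+slack (toℕ x * 4) (arith (toℕ x)))
  where arith : ∀ n → 4 + (1 + n * 4) + n * 4 ≡ 1 + suc (2 * n) * 4
        arith = solve-∀

-- The entry point varies: the helper functions serve both programs.
module Evaluation (main : Exp 11 1) where

  infix 3 _⊢_⇓_within_
  -- Exact times vary with the outcome of tests; an upper bound lets the outcomes share one budget,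
  -- and the rules below add budgets just as evaluation adds times.
  record _⊢_⇓_within_ {n : ℕ} (ρ : Vec Tree n) (e : Exp 11 n) (w : Tree) (budget : ℕ) : Set where
    constructor eval
    field
      {time} : ℕ
      run    : bodiesWith main , ρ ⊢ e ⇓ w ⟨ time ⟩
      bound  : time ≤ budget

  Calls : Fin 11 → Tree → Tree → ℕ → Set
  Calls i u w b = u ∷ [] ⊢ lookup (bodiesWith main) i ⇓ w within b

  module _ {n : ℕ} {ρ : Vec Tree n} where

    within : ∀ {e w b b′} → b ≤ b′ → ρ ⊢ e ⇓ w within b → ρ ⊢ e ⇓ w within b′
    within b≤b′ (eval d t) = eval d (≤-trans t b≤b′)

    ↓ref : ∀ {i} → ρ ⊢ ref i ⇓ lookup ρ i within 1
    ↓ref = eval ref ≤-refl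

    ↓nil : ρ ⊢ nil ⇓ nil within 1
    ↓nil = eval nil ≤-refl

    ↓cons : ∀ {e₁ e₂ w₁ w₂ b₁ b₂} →
            ρ ⊢ e₁ ⇓ w₁ within b₁ → ρ ⊢ e₂ ⇓ w₂ within b₂ →
            ρ ⊢ cons e₁ e₂ ⇓ cons w₁ w₂ within suc (b₁ + b₂)
    ↓cons (eval d t) (eval d′ t′) = eval (cons d d′) (s≤s (+-mono-≤ t t′))

    ↓one : ρ ⊢ cons nil nil ⇓ cons nil nil within 3
    ↓one = ↓cons ↓nil ↓nil

    ↓bind : ∀ {e₁ e₂ w₁ w₂ b₁ b₂} →
            ρ ⊢ e₁ ⇓ w₁ within b₁ → w₁ ∷ ρ ⊢ e₂ ⇓ w₂ within b₂ →
            ρ ⊢ bind e₁ e₂ ⇓ w₂ within suc (b₁ + b₂)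
    ↓bind (eval d t) (eval d′ t′) = eval (bind d d′) (s≤s (+-mono-≤ t t′))

    ↓case-nil : ∀ {e e₁ e₂ w b b₁} →
                ρ ⊢ e ⇓ nil within b → ρ ⊢ e₁ ⇓ w within b₁ →
                ρ ⊢ case e e₁ e₂ ⇓ w within suc (b + b₁)
    ↓case-nil (eval d t) (eval d′ t′) = eval (case-nil d d′) (s≤s (+-mono-≤ t t′))

    ↓case-cons : ∀ {e e₁ e₂ l r w b b₂} →
                 ρ ⊢ e ⇓ cons l r within b → l ∷ r ∷ ρ ⊢ e₂ ⇓ w within b₂ →
                 ρ ⊢ case e e₁ e₂ ⇓ w within suc (b + b₂)
    ↓case-cons (eval d t) (eval d′ t′) = eval (case-cons d d′) (s≤s (+-mono-≤ t t′))

    ↓call : ∀ {i e u w b b′} →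
            ρ ⊢ e ⇓ u within b → Calls i u w b′ →
            ρ ⊢ call i e ⇓ w within suc (b + b′)
    ↓call (eval d t) (eval d′ t′) = eval (call d d′) (s≤s (+-mono-≤ t t′))

  -- Running times of the helpers on numbers and lists

  -- The rate of 20 per tree node is common to the linear-time helpers, generous enough for the
  -- constant work around each recursive call.
  double-cost : ∀ x → Calls double# (codeᵇ x) (codeᵇ (double x)) (size (codeᵇ x) * 20)
  double-cost zero     = within (≤ᵇ⇒≤ _ _ tt) (↓case-nil ↓ref ↓nil)
  double-cost 2[1+ x ] = within (m≤m+slack (29 + s * 20) (arith s))
    (↓case-cons ↓ref (↓case-nil ↓ref (↓cons ↓nil (↓cons ↓one ↓ref))))
    where s = size (codeᵇ x)
          arith : ∀ s → 11 + (29 + s * 20) ≡ (2 + s) * 20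
          arith = solve-∀
  double-cost 1+[2 x ] = within (m≤m+slack 72 (arith s))
    (↓case-cons ↓ref (↓case-cons ↓ref (↓cons ↓nil (↓call ↓ref (double-cost x)))))
    where s = size (codeᵇ x)
          arith : ∀ s → 8 + s * 20 + 72 ≡ (4 + s) * 20
          arith = solve-∀

  module _ {w : Tree} {b : ℕ} where

    unary-odd : ∀ x → Calls unary# (codeᵇ (double x)) w b →
                   Calls unary# (codeᵇ 1+[2 x ]) (cons (cons nil nil) (cons (cons nil nil) w))
                         (b + (30 + size (codeᵇ 1+[2 x ]) * 20))
    unary-odd x c = within (m≤m+slack 95 (arith b (size (codeᵇ x))))
      (↓case-cons ↓ref (↓case-cons ↓ref (↓cons ↓one (↓cons ↓one (↓call (↓call ↓ref (double-cost x)) c)))))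
      where arith : ∀ b s → suc (1 + suc (1 + suc (3 + suc (3 + suc (suc (1 + s * 20) + b))))) + 95 ≡
                            b + (30 + (4 + s) * 20)
            arith = solve-∀

    -- The link between recursion on binary digits and induction on a natural number: on a
    -- successor, the program calls itself on exactly the predecessor. When `2[1+ x ]` carries to
    -- `1+[2 suc x ]`, that predecessor reappears as `double (suc x)`.
    unary-suc : ∀ x → Calls unary# (codeᵇ x) w b →
                Calls unary# (codeᵇ (Binary.suc x)) (cons (cons nil nil) (cons (cons nil nil) w))
                      (b + (30 + size (codeᵇ (Binary.suc x)) * 20))
    unary-suc zero     c = unary-odd zero c
    unary-suc 2[1+ x ] c =
      unary-odd (Binary.suc x) (subst (λ y → Calls unary# (codeᵇ y) w b) (2[1+_]-double-suc x) c)
    unary-suc 1+[2 x ] c = within (m≤m+slack (52 + size (codeᵇ x) * 20) (arith b (size (codeᵇ x))))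
      (↓case-cons ↓ref (↓case-nil ↓ref (↓cons ↓one (↓cons ↓one (↓call (↓cons ↓one ↓ref) c)))))
      where arith : ∀ b s → suc (1 + suc (1 + suc (3 + suc (3 + suc (5 + b))))) + (52 + s * 20) ≡
                            b + (30 + (2 + s) * 20)
            arith = solve-∀

  -- The budget uses the value of the counter, not its length: as that value more than quadruples at
  -- each step, it absorbs a step cost linear in the size of the current number.
  unary-cost : ∀ n → Calls unary# (codeᵇ (fromℕ' n)) (codeᵇ (fuelᵇ n)) (fuel n * 100)
  unary-cost zero    = within (≤ᵇ⇒≤ _ _ tt) (↓case-nil ↓ref (↓cons ↓one ↓nil))
  unary-cost (suc n) = within budget (unary-suc (fromℕ' n) (unary-cost n))
    where
    x = fromℕ' (suc n)
    size-x : size (codeᵇ x) ≤ 1 + fuel n * 4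
    size-x = ≤-trans (size-codeᵇ x) (s≤s (*-monoˡ-≤ 4 (≤-trans (≤-reflexive (toℕ-fromℕ' (suc n))) (n<fuel n))))
    arith : ∀ f → f * 100 + (30 + (1 + f * 4) * 20) + (250 + f * 220) ≡ suc (2 * suc (2 * f)) * 100
    arith = solve-∀
    budget : fuel n * 100 + (30 + size (codeᵇ x) * 20) ≤ fuel (suc n) * 100
    budget = ≤-trans (+-mono-≤ (≤-refl {fuel n * 100}) (+-mono-≤ (≤-refl {30}) (*-monoˡ-≤ 20 size-x)))
                     (m≤m+slack (250 + fuel n * 220) (arith (fuel n)))

  append-cost : ∀ {A : Set} (code : A → Tree) xs ys →
                Calls append# (cons (codeList code xs) (codeList code ys)) (codeList code (xs ++ ys))
                      (size (codeList code xs) * 20)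
  append-cost code []       ys = within (≤ᵇ⇒≤ _ _ tt) (↓case-cons ↓ref (↓case-nil ↓ref ↓ref))
  append-cost code (x ∷ xs) ys = within
    (m≤m+slack (10 + size (code x) * 20) (arith (size (code x)) (size (codeList code xs))))
    (↓case-cons ↓ref (↓case-cons ↓ref (↓cons ↓ref (↓call (↓cons ↓ref ↓ref) (append-cost code xs ys)))))
    where arith : ∀ a s → 10 + s * 20 + (10 + a * 20) ≡ suc (a + s) * 20
          arith = solve-∀

  eq-cost : ∀ x y → Calls eq# (cons (codeᵇ x) (codeᵇ y)) (codeBool (does (x ≟ y))) (size (codeᵇ x) * 20)
  eq-cost zero     zero     = within (≤ᵇ⇒≤ _ _ tt) (↓case-cons ↓ref (↓case-nil ↓ref (↓case-nil ↓ref ↓one)))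
  eq-cost zero     2[1+ y ] = within (≤ᵇ⇒≤ _ _ tt) (↓case-cons ↓ref (↓case-nil ↓ref (↓case-cons ↓ref ↓nil)))
  eq-cost zero     1+[2 y ] = within (≤ᵇ⇒≤ _ _ tt) (↓case-cons ↓ref (↓case-nil ↓ref (↓case-cons ↓ref ↓nil)))
  eq-cost 2[1+ x ] zero     = within (m≤m+n _ _)
    (↓case-cons ↓ref (↓case-cons ↓ref (↓case-nil ↓ref ↓nil)))
  eq-cost 1+[2 x ] zero     = within (m≤m+n _ _)
    (↓case-cons ↓ref (↓case-cons ↓ref (↓case-nil ↓ref ↓nil)))
  eq-cost 2[1+ x ] 2[1+ y ] = within (m≤m+slack 26 (arith (size (codeᵇ x))))
    (↓case-cons ↓ref (↓case-cons ↓ref (↓case-cons ↓ref (↓case-nil ↓ref (↓case-nil ↓ref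
      (↓call (↓cons ↓ref ↓ref) (eq-cost x y)))))))
    where arith : ∀ s → 14 + s * 20 + 26 ≡ (2 + s) * 20
          arith = solve-∀
  eq-cost 2[1+ x ] 1+[2 y ] = within (m≤m+n _ _)
    (↓case-cons ↓ref (↓case-cons ↓ref (↓case-cons ↓ref (↓case-nil ↓ref (↓case-cons ↓ref ↓nil)))))
  eq-cost 1+[2 x ] 2[1+ y ] = within (m≤m+n _ _)
    (↓case-cons ↓ref (↓case-cons ↓ref (↓case-cons ↓ref (↓case-cons ↓ref (↓case-nil ↓ref ↓nil)))))
  eq-cost 1+[2 x ] 1+[2 y ] = within (m≤m+slack 66 (arith (size (codeᵇ x))))
    (↓case-cons ↓ref (↓case-cons ↓ref (↓case-cons ↓ref (↓case-cons ↓ref (↓case-cons ↓ref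
      (↓call (↓cons ↓ref ↓ref) (eq-cost x y)))))))
    where arith : ∀ s → 14 + s * 20 + 66 ≡ (4 + s) * 20
          arith = solve-∀

-- Price polynomials and the exponent of the running time

delete-price : Var → ℕ
delete-price x = 30 + size (codeᵇ x) * 20

-- The work apart from recursive searches. The lists and the chosen variable both have size at most
-- `s`, whence the quadratic term; a node pays for `find` and up to three branches.
branch-price node-price : ℕ → ℕ
branch-price s = 30 + s * (30 + s * 20)
node-price   s = 40 + (s * 20 + branch-price s * 3)

-- The exponent 6 is two for the quadratic work and four to absorb the constant, as `430 ≤ 5 ^ 4`.
-- An encoded instance has size at least 5: two `cons` nodes and three subtrees.
polynomial-bound : ∀ N → 5 ≤ N → 240 + (N * 130 + N ^ 2 * 60) ≤ N ^ 6
polynomial-bound N 5≤N = begin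
  240 + (N * 130 + N ^ 2 * 60)
    ≤⟨ +-mono-≤ (*-monoˡ-≤ 240 1≤N²) (+-monoˡ-≤ (N ^ 2 * 60) (*-monoˡ-≤ 130 N≤N²)) ⟩
  N ^ 2 * 240 + (N ^ 2 * 130 + N ^ 2 * 60)  ≡⟨ arith (N ^ 2) ⟩
  N ^ 2 * 430                               ≤⟨ *-monoʳ-≤ (N ^ 2) (≤ᵇ⇒≤ 430 625 tt) ⟩
  N ^ 2 * 5 ^ 4                             ≤⟨ *-monoʳ-≤ (N ^ 2) (^-monoˡ-≤ 4 5≤N) ⟩
  N ^ 2 * N ^ 4                             ≡⟨ sym (^-distribˡ-+-* N 2 4) ⟩
  N ^ 6                                     ∎
  where
  open ≤-Reasoning
  1≤N : 1 ≤ N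
  1≤N = ≤-trans (s≤s z≤n) 5≤N
  1≤N² : 1 ≤ N ^ 2
  1≤N² = ^-monoˡ-≤ 2 1≤N
  N≤N² : N ≤ N ^ 2
  N≤N² = ≤-trans (≤-reflexive (sym (*-identityʳ N))) (*-monoʳ-≤ N (≤-trans 1≤N (≤-reflexive (sym (*-identityʳ N)))))
  arith : ∀ q → q * 240 + (q * 130 + q * 60) ≡ q * 430
  arith = solve-∀

main-price : ∀ f P N → 1 ≤ f → P ≤ N → 5 ≤ N →
             8 + ((f * 100 + (2 + P * 20)) + f * node-price N) ≤ f * N ^ 6
main-price (suc f) P N _ P≤N 5≤N = begin
  8 + (suc f * 100 + (2 + P * 20) + suc f * node-price N)
    ≤⟨ +-monoʳ-≤ 8 (+-monoˡ-≤ (suc f * node-price N) (+-monoʳ-≤ (suc f * 100) (+-monoʳ-≤ 2 (*-monoˡ-≤ 20 P≤N)))) ⟩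
  8 + (suc f * 100 + (2 + N * 20) + suc f * node-price N)
    ≤⟨ m≤m+slack (f * (10 + N * 20)) (arith f N) ⟩
  suc f * (240 + (N * 130 + N ^ 2 * 60))
    ≤⟨ *-monoʳ-≤ (suc f) (polynomial-bound N 5≤N) ⟩
  suc f * N ^ 6  ∎
  where
  open ≤-Reasoning
  arith : ∀ f N → 8 + (suc f * 100 + (2 + N * 20) + suc f * (40 + (N * 20 + (30 + N * (30 + N * 20)) * 3))) +
                  f * (10 + N * 20) ≡
                  suc f * (240 + (N * 130 + N * (N * 1) * 60))
  arith = solve-∀

-- Running times of the operations on clauses

module _ {𝒪 : OpSet} where

  private
    Lit = Literal 𝒪

  codeLits : List Lit → Tree
  codeLits = codeList codeLiteral

  codeCs : List (List Lit) → Tree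
  codeCs = codeList codeLits

  codeTriple : Lit × Lit × Lit → Tree
  codeTriple (a , b , c) = cons (codeLiteral a) (cons (codeLiteral b) (codeLiteral c))

  -- Deletion never enlarges the input, so the size at the root bounds the work at every node of the
  -- search tree.
  size-delete : ∀ x ls → size (codeLits (delete x ls)) ≤ size (codeLits ls)
  size-delete x []       = ≤-refl
  size-delete x (l ∷ ls) with mentions x l
  ... | true  = m≤n⇒m≤1+n (≤-trans (size-delete x ls) (m≤n+m _ (size (codeLiteral l))))
  ... | false = s≤s (+-mono-≤ (≤-refl {size (codeLiteral l)}) (size-delete x ls))

  size-deleteAll : ∀ x Cs → size (codeCs (map (delete x) Cs)) ≤ size (codeCs Cs)
  size-deleteAll x []       = ≤-refl
  size-deleteAll x (C ∷ Cs) = s≤s (+-mono-≤ (size-delete x C) (size-deleteAll x Cs))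

  size-flat : ∀ Cs → size (codeCs (map literals Cs)) ≤ size (codeList (codeClause {𝒪}) Cs)
  size-flat []                  = ≤-refl
  size-flat (clause ns ps ∷ Cs) = s≤s (+-mono-≤ (size-++ ns) (size-flat Cs))
    where
    size-++ : ∀ ns → size (codeLits (ns ++ ps)) ≤ size (cons (codeLits ns) (codeLits ps))
    size-++ []       = m≤n+m _ 2
    size-++ (l ∷ ns) = s≤s (≤-trans (+-mono-≤ (≤-refl {size (codeLiteral l)}) (size-++ ns))
                                    (≤-reflexive (arith (size (codeLiteral l)) (size (codeLits ns)) (size (codeLits ps)))))
      where
      arith : ∀ l n p → l + suc (n + p) ≡ suc (l + n) + p
      arith = solve-∀

  open Evaluation mainBody

  flat-cost : ∀ Φ → Calls flat# (codeList codeClause Φ) (codeCs (map literals Φ))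
                          (size (codeList codeClause Φ) * 20)
  flat-cost []                 = within (≤ᵇ⇒≤ _ _ tt) (↓case-nil ↓ref ↓nil)
  flat-cost (clause ns ps ∷ Φ) = within (m≤m+slack (33 + size (codeLits ps) * 20)
                                          (arith (size (codeLits ns)) (size (codeLits ps)) (size (codeList codeClause Φ))))
    (↓case-cons ↓ref (↓cons (↓call ↓ref (append-cost codeLiteral ns ps)) (↓call ↓ref (flat-cost Φ))))
    where arith : ∀ n p r → 3 + ((2 + n * 20) + (2 + r * 20)) + (33 + p * 20) ≡ suc (suc (n + p) + r) * 20
          arith = solve-∀

  delete-cost : ∀ x ls → Calls delete# (cons (codeᵇ x) (codeLits ls)) (codeLits (delete x ls))
                               (size (codeLits ls) * delete-price x)
  delete-cost x []       = within (m≤m+n _ _) (↓case-cons ↓ref (↓case-nil ↓ref ↓nil))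
  delete-cost x (l ∷ ls) = step l
    where
    K = delete-price x
    s = size (codeᵇ x)
    r = size (codeLits ls)

    -- The new `cons` node alone contributes one `K = 30 + s * 20`, which pays the fixed 9 and the
    -- treatment `q` of the head, including one comparison.
    price : ∀ a {q} → q ≤ 10 + s * 20 → 9 + (r * K + q) ≤ suc (a + r) * K
    price a q≤ = ≤-trans (+-mono-≤ (≤-refl {9}) (+-mono-≤ (≤-refl {r * K}) q≤))
                         (m≤m+slack (11 + a * K) (arith s a r))
      where
      arith : ∀ s a r → 9 + (r * (30 + s * 20) + (10 + s * 20)) + (11 + a * (30 + s * 20)) ≡
                        suc (a + r) * (30 + s * 20)
      arith = solve-∀

    hit-price : ∀ {c} → c ≤ 3 → 3 + ((4 + s * 20) + c) ≤ 10 + s * 20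
    hit-price c≤ = ≤-trans (+-mono-≤ (≤-refl {7 + s * 20}) c≤) (≤-reflexive (arith s))
      where
      arith : ∀ s → 7 + s * 20 + 3 ≡ 10 + s * 20
      arith = solve-∀

    -- Variables and boxed variables differ only in the tag, which the program copies without
    -- inspecting it.
    test : ∀ tag y →
           Calls delete# (cons (codeᵇ x) (cons (cons tag (codeᵇ y)) (codeLits ls)))
                 (if does (x ≟ y) then codeLits (delete x ls)
                                  else cons (cons tag (codeᵇ y)) (codeLits (delete x ls)))
                 (suc (size (cons tag (codeᵇ y)) + r) * K)
    test tag y with does (x ≟ y) | eq-cost x y
    ... | true  | c = within (price (size (cons tag (codeᵇ y))) (hit-price (s≤s z≤n)))
      (↓case-cons ↓ref (↓case-cons ↓ref (↓bind (↓call (↓cons ↓ref ↓ref) (delete-cost x ls))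
        (↓case-cons ↓ref (↓case-cons (↓call (↓cons ↓ref ↓ref) c) ↓ref)))))
    ... | false | c = within (price (size (cons tag (codeᵇ y))) (hit-price ≤-refl))
      (↓case-cons ↓ref (↓case-cons ↓ref (↓bind (↓call (↓cons ↓ref ↓ref) (delete-cost x ls))
        (↓case-cons ↓ref (↓case-nil (↓call (↓cons ↓ref ↓ref) c) (↓cons ↓ref ↓ref))))))

    step : ∀ l → Calls delete# (cons (codeᵇ x) (codeLits (l ∷ ls))) (codeLits (delete x (l ∷ ls)))
                       (size (codeLits (l ∷ ls)) * K)
    step ⊥ˡ = within (price 1 (m≤m+n _ _))
      (↓case-cons ↓ref (↓case-cons ↓ref (↓bind (↓call (↓cons ↓ref ↓ref) (delete-cost x ls))
        (↓case-nil ↓ref (↓cons ↓ref ↓ref)))))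
    step (var y) with does (x ≟ y) | test nil y
    ... | true  | c = c
    ... | false | c = c
    step (box O _ y) with does (x ≟ y) | test (cons nil (codeOp O)) y
    ... | true  | c = c
    ... | false | c = c

  deleteAll-cost : ∀ x Cs → Calls deleteAll# (cons (codeᵇ x) (codeCs Cs)) (codeCs (map (delete x) Cs))
                                  (size (codeCs Cs) * delete-price x)
  deleteAll-cost x []       = within (m≤m+n _ _) (↓case-cons ↓ref (↓case-nil ↓ref ↓nil))
  deleteAll-cost x (C ∷ Cs) = within
    (m≤m+slack (17 + size (codeᵇ x) * 20) (arith (size (codeᵇ x)) (size (codeLits C)) (size (codeCs Cs))))
    (↓case-cons ↓ref (↓case-cons ↓ref
      (↓cons (↓call (↓cons ↓ref ↓ref) (delete-cost x C)) (↓call (↓cons ↓ref ↓ref) (deleteAll-cost x Cs)))))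
    where
    arith : ∀ s c r → 5 + ((4 + c * (30 + s * 20)) + (4 + r * (30 + s * 20))) + (17 + s * 20) ≡
                      suc (c + r) * (30 + s * 20)
    arith = solve-∀

  find-cost : ∀ Cs → Calls find# (codeCs Cs) (codeMaybe codeTriple (find Cs)) (size (codeCs Cs) * 20)
  find-cost [] = within (≤ᵇ⇒≤ _ _ tt) (↓case-nil ↓ref ↓nil)
  find-cost ([] ∷ Cs) = within (m≤m+slack 34 (arith (size (codeCs Cs))))
    (↓case-cons ↓ref (↓case-nil ↓ref (↓call ↓ref (find-cost Cs))))
    where
    arith : ∀ r → 6 + r * 20 + 34 ≡ (2 + r) * 20
    arith = solve-∀
  find-cost ((a ∷ []) ∷ Cs) = within
    (m≤m+slack (52 + size (codeLiteral a) * 20) (arith (size (codeLiteral a)) (size (codeCs Cs))))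
    (↓case-cons ↓ref (↓case-cons ↓ref (↓case-nil ↓ref (↓call ↓ref (find-cost Cs)))))
    where
    arith : ∀ a r → 8 + r * 20 + (52 + a * 20) ≡ suc (suc (a + 1) + r) * 20
    arith = solve-∀
  find-cost ((a ∷ b ∷ []) ∷ Cs) = within
    (m≤m+slack (70 + size (codeLiteral a) * 20 + size (codeLiteral b) * 20)
               (arith (size (codeLiteral a)) (size (codeLiteral b)) (size (codeCs Cs))))
    (↓case-cons ↓ref (↓case-cons ↓ref (↓case-cons ↓ref (↓case-nil ↓ref (↓call ↓ref (find-cost Cs))))))
    where
    arith : ∀ a b r → 10 + r * 20 + (70 + a * 20 + b * 20) ≡ suc (suc (a + suc (b + 1)) + r) * 20
    arith = solve-∀
  find-cost ((a ∷ b ∷ c ∷ ls) ∷ Cs) = within (m≤m+n _ _)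
    (↓case-cons ↓ref (↓case-cons ↓ref (↓case-cons ↓ref (↓case-cons ↓ref
      (↓cons ↓nil (↓cons ↓ref (↓cons ↓ref ↓ref)))))))

  -- Running time of branching and of the whole search

  module _ {s k b : ℕ}
           (rec-cost : ∀ Cs → size (codeCs Cs) ≤ s →
                       Calls search# (cons (codeᵇ (fuelᵇ k)) (codeCs Cs)) (codeAnswer (search k Cs)) b)
           (Cs : List (List Lit)) (Cs≤s : size (codeCs Cs) ≤ s) where

    branchOn-cost : ∀ tag x → size (codeᵇ x) ≤ s →
                    Calls branch# (cons (cons tag (codeᵇ x)) (cons (codeᵇ (fuelᵇ k)) (codeCs Cs)))
                          (codeAnswer (branchOn (search k) Cs x)) (branch-price s + b)
    branchOn-cost tag x x≤s = go (search k Cs′) (rec-cost Cs′ (≤-trans (size-deleteAll x Cs) Cs≤s))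
      where
      Cs′ = map (delete x) Cs
      d = size (codeCs Cs) * delete-price x

      budget : ∀ {q} → q ≤ 5 → 14 + (d + b + q) ≤ branch-price s + b
      budget q≤ = ≤-trans
        (+-monoʳ-≤ 14 (+-mono-≤ (+-monoˡ-≤ b (*-mono-≤ Cs≤s (+-monoʳ-≤ 30 (*-monoˡ-≤ 20 x≤s)))) q≤))
        (m≤m+slack 11 (arith s b))
        where
        arith : ∀ s b → 14 + (s * (30 + s * 20) + b + 5) + 11 ≡ 30 + s * (30 + s * 20) + b
        arith = solve-∀

      go : ∀ X → Calls search# (cons (codeᵇ (fuelᵇ k)) (codeCs Cs′)) (codeAnswer X) b →
           Calls branch# (cons (cons tag (codeᵇ x)) (cons (codeᵇ (fuelᵇ k)) (codeCs Cs)))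
                 (codeAnswer (Maybe.map (x ∷_) X)) (branch-price s + b)
      go nothing  c = within (budget (s≤s z≤n)) (↓case-cons ↓ref (↓case-cons ↓ref (↓case-cons ↓ref
        (↓case-nil (↓call (↓cons ↓ref (↓call (↓cons ↓ref ↓ref) (deleteAll-cost x Cs))) c) ↓nil))))
      go (just X) c = within (budget ≤-refl) (↓case-cons ↓ref (↓case-cons ↓ref (↓case-cons ↓ref
        (↓case-cons (↓call (↓cons ↓ref (↓call (↓cons ↓ref ↓ref) (deleteAll-cost x Cs))) c)
          (↓cons ↓nil (↓cons ↓ref ↓ref))))))

    branch-cost : ∀ l → size (codeLiteral l) ≤ s →
                  Calls branch# (cons (codeLiteral l) (cons (codeᵇ (fuelᵇ k)) (codeCs Cs)))
                        (codeAnswer (branch (search k) Cs l)) (branch-price s + b)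
    branch-cost ⊥ˡ          l≤s = within (m≤m+n _ _) (↓case-cons ↓ref (↓case-nil ↓ref ↓nil))
    branch-cost (var x)     l≤s = branchOn-cost nil x (≤-trans (m≤n+m _ 2) l≤s)
    branch-cost (box O _ x) l≤s = branchOn-cost (cons nil (codeOp O)) x
      (≤-trans (m≤n+m _ (suc (size (cons nil (codeOp O))))) l≤s)

  base-price : ∀ k s Cs {q} → size (codeCs Cs) ≤ s → q ≤ 20 →
               5 + (size (codeCs Cs) * 20 + q) ≤ fuel k * node-price s
  base-price k s Cs Cs≤s q≤ = ≤-trans
    (+-mono-≤ (≤-refl {5}) (+-mono-≤ (*-monoˡ-≤ 20 Cs≤s) q≤))
    (≤-trans (m≤m+slack (15 + branch-price s * 3) (arith s (branch-price s)))
             (*-monoˡ-≤ (node-price s) (≤-trans (s≤s z≤n) (n<fuel k))))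
    where
    arith : ∀ s b → 5 + (s * 20 + 20) + (15 + b * 3) ≡ 1 * (40 + (s * 20 + b * 3))
    arith = solve-∀

  -- An arbitrary `s` above the current size keeps the node price the same throughout the tree, so
  -- the recurrence over the depth has constant coefficients.
  search-cost : ∀ k {s} Cs → size (codeCs Cs) ≤ s →
                Calls search# (cons (codeᵇ (fuelᵇ k)) (codeCs Cs)) (codeAnswer (search k Cs))
                      (fuel k * node-price s)
  search-cost k {s} Cs Cs≤s with find Cs in found | find-cost Cs
  search-cost k {s} Cs Cs≤s | nothing | c = within (base-price k s Cs Cs≤s (m≤m+n _ _))
    (↓case-cons ↓ref (↓case-nil (↓call ↓ref c) ↓one))
  search-cost zero {s} Cs Cs≤s | just (x , y , z) | c = within (base-price zero s Cs Cs≤s (m≤m+n _ _))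
    (↓case-cons ↓ref (↓case-cons (↓call ↓ref c)
      (↓case-cons ↓ref (↓case-cons ↓ref (↓case-cons ↓ref (↓case-nil ↓ref ↓nil))))))
  search-cost (suc k) {s} Cs Cs≤s | just (x , y , z) | c with C , C∈ ← find-just Cs found =
    go (member (here refl)) (member (there (here refl))) (member (there (there (here refl))))
    where
    p = branch-price s + fuel k * node-price s

    member : ∀ {l} → l ∈ (x ∷ y ∷ z ∷ C) → size (codeLiteral l) ≤ s
    member l∈ = ≤-trans (size-∈ codeLiteral l∈) (≤-trans (size-∈ codeLits C∈) Cs≤s)

    try : ∀ l → size (codeLiteral l) ≤ s →
          Calls branch# (cons (codeLiteral l) (cons (codeᵇ (fuelᵇ k)) (codeCs Cs)))
                (codeAnswer (branch (search k) Cs l)) p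
    try = branch-cost (λ Cs′ → search-cost k Cs′) Cs Cs≤s

    budget : ∀ {q} → q ≤ 14 + p * 3 →
             5 + (size (codeCs Cs) * 20 + (12 + q)) ≤ fuel (suc k) * node-price s
    budget q≤ = ≤-trans
      (+-mono-≤ (≤-refl {5}) (+-mono-≤ (*-monoˡ-≤ 20 Cs≤s) (+-mono-≤ (≤-refl {12}) q≤)))
      -- Of the `3 + 4 * fuel k` node prices available, one covers this node up to the remainder 9
      -- and `3 * fuel k` cover the subtrees; the rest is slack.
      (m≤m+slack (9 + node-price s * 2 + fuel k * node-price s) (arith s (branch-price s) (fuel k)))
      where
      arith : ∀ s b f → 5 + (s * 20 + (12 + (14 + (b + f * (40 + (s * 20 + b * 3))) * 3))) +
                        (9 + (40 + (s * 20 + b * 3)) * 2 + f * (40 + (s * 20 + b * 3))) ≡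
                        suc (2 * suc (2 * f)) * (40 + (s * 20 + b * 3))
      arith = solve-∀

    one-try : 5 + (p + 3) ≤ 14 + p * 3
    one-try = m≤m+slack (6 + p * 2) (arith p)
      where
      arith : ∀ p → 5 + (p + 3) + (6 + p * 2) ≡ 14 + p * 3
      arith = solve-∀

    two-tries : 5 + (p + (5 + (p + 3))) ≤ 14 + p * 3
    two-tries = m≤m+slack (1 + p) (arith p)
      where
      arith : ∀ p → 5 + (p + (5 + (p + 3))) + (1 + p) ≡ 14 + p * 3
      arith = solve-∀

    three-tries : 5 + (p + (5 + (p + (4 + p)))) ≤ 14 + p * 3
    three-tries = ≤-reflexive (arith p)
      where
      arith : ∀ p → 5 + (p + (5 + (p + (4 + p)))) ≡ 14 + p * 3
      arith = solve-∀

    go : size (codeLiteral x) ≤ s → size (codeLiteral y) ≤ s → size (codeLiteral z) ≤ s →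
         Calls search# (cons (codeᵇ (fuelᵇ (suc k))) (codeCs Cs))
               (codeAnswer (branches (search k) Cs (x , y , z))) (fuel (suc k) * node-price s)
    go x≤ y≤ z≤ with branch (search k) Cs x | try x x≤
    ... | just _  | tx = within (budget one-try) (↓case-cons ↓ref (↓case-cons (↓call ↓ref c)
      (↓case-cons ↓ref (↓case-cons ↓ref (↓case-cons ↓ref (↓case-cons ↓ref (↓bind (↓cons ↓ref ↓ref)
        (↓case-cons (↓call (↓cons ↓ref ↓ref) tx) (↓cons ↓ref ↓ref)))))))))
    ... | nothing | tx with branch (search k) Cs y | try y y≤
    ...   | just _  | ty = within (budget two-tries) (↓case-cons ↓ref (↓case-cons (↓call ↓ref c)
      (↓case-cons ↓ref (↓case-cons ↓ref (↓case-cons ↓ref (↓case-cons ↓ref (↓bind (↓cons ↓ref ↓ref)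
        (↓case-nil (↓call (↓cons ↓ref ↓ref) tx)
          (↓case-cons (↓call (↓cons ↓ref ↓ref) ty) (↓cons ↓ref ↓ref))))))))))
    ...   | nothing | ty = within (budget three-tries) (↓case-cons ↓ref (↓case-cons (↓call ↓ref c)
      (↓case-cons ↓ref (↓case-cons ↓ref (↓case-cons ↓ref (↓case-cons ↓ref (↓bind (↓cons ↓ref ↓ref)
        (↓case-nil (↓call (↓cons ↓ref ↓ref) tx)
          (↓case-nil (↓call (↓cons ↓ref ↓ref) ty) (↓call (↓cons ↓ref ↓ref) (try z z≤)))))))))))

  search-program-cost : ∀ (I : DetectInstance 𝒪) → let open DetectInstance I in
    Calls zero (cons (codeFormula φ) (codeℕ k)) (codeAnswer (solution I))
      (fuel k * size (cons (codeFormula φ) (codeℕ k)) ^ 6)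
  search-program-cost I = within budget
    (↓case-cons ↓ref (↓case-cons ↓ref
      (↓call (↓cons (↓call ↓ref unary) (↓call ↓ref (flat-cost Cs))) (search-cost k (map literals Cs) flat≤N))))
    where
    open DetectInstance I
    Cs = Φ φ
    Ψ-size = size (codeList codeᵇ (Ψ φ))
    Φ-size = size (codeList codeClause Cs)
    k-size = size (codeℕ k)
    N = size (cons (codeFormula φ) (codeℕ k))

    unary : Calls unary# (codeℕ k) (codeᵇ (fuelᵇ k)) (fuel k * 100)
    unary = subst (λ x → Calls unary# (codeᵇ x) (codeᵇ (fuelᵇ k)) (fuel k * 100))
                  (sym (fromℕ≡fromℕ' k)) (unary-cost k)

    Φ≤N : Φ-size ≤ N
    Φ≤N = m≤n⇒m≤1+n (m≤n⇒m≤1+n (≤-trans (m≤n+m Φ-size Ψ-size) (m≤m+n _ k-size)))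

    flat≤N : size (codeCs (map literals Cs)) ≤ N
    flat≤N = ≤-trans (size-flat Cs) Φ≤N

    5≤N : 5 ≤ N
    5≤N = s≤s (s≤s (+-mono-≤ (+-mono-≤ (size>0 (codeList codeᵇ (Ψ φ))) (size>0 (codeList codeClause Cs)))
                             (size>0 (codeℕ k))))

    budget : 8 + ((fuel k * 100 + (2 + Φ-size * 20)) + fuel k * node-price N) ≤ fuel k * N ^ 6
    budget = main-price (fuel k) Φ-size N (≤-trans (s≤s z≤n) (n<fuel k)) Φ≤N 5≤N

-- Computability of the parameter bound and fixed-parameter tractability

fuel-computable : Computable fuel
fuel-computable = fuel-program , λ n → time (cost n) ,
  -- Numerals with digits 1 and 2 are unique, so the numeral `fuelᵇ n` built by the program is the
  -- code of its own value.
  subst₂ (λ x y → Runs fuel-program (codeᵇ x) (codeᵇ y) (time (cost n)))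
         (sym (fromℕ≡fromℕ' n)) (sym (fromℕ-toℕ (fuelᵇ n))) (run (cost n))
  where
  open Evaluation fuelBody
  open _⊢_⇓_within_
  cost : ∀ n → Calls zero (codeᵇ (fromℕ' n)) (codeᵇ (fuelᵇ n)) (suc (1 + fuel n * 100))
  cost n = ↓call ↓ref (unary-cost n)

theorem6 : (𝒪 : OpSet) → FixedParameterTractable (Detect 𝒪 KROM)
theorem6 𝒪 = fuel , fuel-computable , search-program , 6 , λ I →
  solution I , time (search-program-cost I) ,
  solution-correct I , run (search-program-cost I) , bound (search-program-cost I)
  where open Evaluation._⊢_⇓_within_
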